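{- For all $n\ge 0$, the quadruples of statistics $(\operatorname{asc},\operatorname{des},\operatorname{MNA},\operatorname{MND})$ and $(\operatorname{des},\operatorname{asc},\operatorname{MND},\operatorname{MNA})$ are equidistributed on $S_n(213,231)$, i.e. $$\sum_{\pi\in S_n(213,231)} t_1^{\operatorname{asc}(\pi)}t_2^{\operatorname{des}(\pi)}t_3^{\operatorname{MNA}(\pi)}t_4^{\operatorname{MND}(\pi)}=\sum_{\pi\in S_n(213,231)} t_1^{\operatorname{des}(\pi)}t_2^{\operatorname{asc}(\pi)}t_3^{\operatorname{MND}(\pi)}t_4^{\operatorname{MNA}(\pi)}.$$
   Context: For $n\ge 0$, $S_n$ denotes the set of permutations $\pi=\pi_1\cdots\pi_n$ of $[n]=\{1,\dots,n\}$. $\pi$ avoids a pattern $\tau\in S_k$ if no subsequence $\pi_{i_1}\cdots\pi_{i_k}$ ($i_1<\dots<i_k$) satisfies $\pi_{i_a}<\pi_{i_b}\iff\tau_a<\tau_b$; $S_n(\tau,\rho)$ is the set of permutations in $S_n$ avoiding both $\tau$ and $\rho$. $\operatorname{asc}(\pi)$ (resp. $\operatorname{des}(\pi)$) is the number of $i\in[n-1]$ with $\pi_i<\pi_{i+1}$ (resp. $\pi_i>\pi_{i+1}$). $\operatorname{MNA}(\pi)$ is the maximum size of a set $I\subseteq[n-1]$ such that $\pi_i<\pi_{i+1}$ for all $i\in I$ and $|i-j|\ge 2$ for distinct $i,j\in I$; $\operatorname{MND}(\pi)$ is defined analogously with $\pi_i>\pi_{i+1}$. -}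

module Defs where

open import Algebra.Bundles using (CommutativeRing)
import Algebra.Properties.Semiring.Exp as Exp
open import Data.Bool using (Bool; true; false)
open import Data.Fin using (Fin; toℕ; _<_; #_)
open import Data.Fin.Properties using (_≟_; _<?_; any?; all?)
open import Data.Fin.Subset using (Subset; ∣_∣; _∈_)
open import Data.Fin.Subset.Properties using (_∈?_)
open import Data.List as List using (List; []; _∷_; length; map; filter; allFin; cartesianProductWith)
open import Data.List.Extrema.Nat using (max)
import Data.List.Membership.Propositional as Mem
open import Data.List.Membership.Propositional.Properties
  using (∈-cartesianProductWith⁺; ∈-allFin; ∈-filter⁺; ∈-filter⁻)
open import Data.List.Relation.Unary.All as All using ()
open import Data.List.Relation.Unary.AllPairs as AllPairs using ()
open import Data.List.Relation.Unary.Any as Any using (here)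
open import Data.List.Relation.Unary.Unique.Propositional using (Unique)
import Data.List.Relation.Unary.Unique.Propositional.Properties as Unique
open import Data.Nat as ℕ using (ℕ; zero; suc)
open import Data.Nat.Properties as ℕ using ()
open import Data.Product using (∃; _×_; _,_; proj₁; proj₂)
open import Data.Product.Properties using (≡-dec)
open import Data.Vec as Vec using (Vec; []; _∷_; lookup)
open import Data.Vec.Properties using (∷-injective)
open import Function using (_⇔_; mk⇔; Equivalence)
open import Function.Consequences.Propositional using (strictlySurjective⇒surjective)
open import Function.Definitions using (Injective; Surjective; Bijective)
open import Level using (0ℓ)
open import Relation.Binary using (DecidableEquality)
open import Relation.Binary.PropositionalEquality using (_≡_; _≢_; refl)
open import Relation.Nullary using (¬_; Dec)
open import Relation.Nullary.Decidable using (map′; _×-dec_; _→-dec_; ¬?)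
open import Relation.Unary using (Pred; Decidable)

-- All vectors of length k with entries in xs.
vectors : {A : Set} → List A → (k : ℕ) → List (Vec A k)
vectors xs zero    = [] ∷ []
vectors xs (suc k) = cartesianProductWith _∷_ xs (vectors xs k)

vectors-complete : {A : Set} {xs : List A} → (∀ a → a Mem.∈ xs) →
                   ∀ {k} (v : Vec A k) → v Mem.∈ vectors xs k
vectors-complete all []      = here refl
vectors-complete all (a ∷ v) = ∈-cartesianProductWith⁺ _∷_ (all a) (vectors-complete all v)

vectors-unique : {A : Set} {xs : List A} → Unique xs → ∀ k → Unique (vectors xs k)
vectors-unique u zero    = All.[] AllPairs.∷ AllPairs.[]
vectors-unique u (suc k) =
  Unique.cartesianProductWith⁺ _∷_ ∷-injective u (vectors-unique u k)

-- One-line notation π₁⋯πₙ, with positions and letters counted from 0.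
Word : ℕ → Set
Word n = Vec (Fin n) n

IsPermutation : ∀ {n} → Pred (Word n) 0ℓ
IsPermutation π = Bijective _≡_ _≡_ (lookup π)

isPermutation? : ∀ {n} → Decidable (IsPermutation {n})
isPermutation? π = injective? ×-dec surjective?
  where
  injective? : Dec (Injective _≡_ _≡_ (lookup π))
  injective? = map′ (λ f {i} {j} → f i j) (λ f i j → f)
    (all? λ i → all? λ j → (lookup π i ≟ lookup π j) →-dec (i ≟ j))

  surjective? : Dec (Surjective _≡_ _≡_ (lookup π))
  surjective? = map′ strictlySurjective⇒surjective (λ s y → proj₁ (s y) , proj₂ (s y) refl)
    (all? λ y → any? λ i → lookup π i ≟ y)

-- ι lists the positions i₁ < ⋯ < i_k of an occurrence of τ in π.
IsOccurrence : ∀ {k n} → Word k → Word n → Pred (Vec (Fin n) k) 0ℓ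
IsOccurrence τ π ι =
  (∀ a b → a < b → lookup ι a < lookup ι b) ×
  (∀ a b → lookup π (lookup ι a) < lookup π (lookup ι b) ⇔ lookup τ a < lookup τ b)

isOccurrence? : ∀ {k n} (τ : Word k) (π : Word n) → Decidable (IsOccurrence τ π)
isOccurrence? τ π ι =
  (all? λ a → all? λ b → (a <? b) →-dec (lookup ι a <? lookup ι b)) ×-dec
  (all? λ a → all? λ b → ⇔-dec (lookup π (lookup ι a) <? lookup π (lookup ι b))
                               (lookup τ a <? lookup τ b))
  where
  ⇔-dec : {P Q : Set} → Dec P → Dec Q → Dec (P ⇔ Q)
  ⇔-dec p? q? = map′ (λ (f , g) → mk⇔ f g) (λ e → Equivalence.to e , Equivalence.from e)
    ((p? →-dec q?) ×-dec (q? →-dec p?))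

Contains : ∀ {k n} → Word n → Word k → Set
Contains π τ = ∃ (IsOccurrence τ π)

contains? : ∀ {k n} (π : Word n) (τ : Word k) → Dec (Contains π τ)
contains? {k} {n} π τ = map′ Any.satisfied
  (λ (ι , occ) → Mem.lose (vectors-complete ∈-allFin ι) occ)
  (Any.any? (isOccurrence? τ π) (vectors (allFin n) k))

Avoids : ∀ {k n} → Word n → Word k → Set
Avoids π τ = ¬ Contains π τ

IsAvoider : ∀ {k l n} → Word k → Word l → Pred (Word n) 0ℓ
IsAvoider τ ρ π = IsPermutation π × Avoids π τ × Avoids π ρ

isAvoider? : ∀ {k l n} (τ : Word k) (ρ : Word l) → Decidable (IsAvoider {n = n} τ ρ)
isAvoider? τ ρ π = isPermutation? π ×-dec ¬? (contains? π τ) ×-dec ¬? (contains? π ρ)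

-- Sₙ(τ, ρ) as a list; the two lemmas below say that it enumerates the set
-- without repetition.
S : ∀ {k l} (n : ℕ) → Word k → Word l → List (Word n)
S n τ ρ = filter (isAvoider? τ ρ) (vectors (allFin n) n)

∈-S⇔ : ∀ {k l n} {τ : Word k} {ρ : Word l} {π : Word n} → π Mem.∈ S n τ ρ ⇔ IsAvoider τ ρ π
∈-S⇔ {n = n} {τ} {ρ} {π} = mk⇔
  (λ π∈S → proj₂ (∈-filter⁻ (isAvoider? τ ρ) {xs = vectors (allFin n) n} π∈S))
  (∈-filter⁺ (isAvoider? τ ρ) (vectors-complete ∈-allFin π))

S-unique : ∀ {k l} n (τ : Word k) (ρ : Word l) → Unique (S n τ ρ)
S-unique n τ ρ = Unique.filter⁺ (isAvoider? τ ρ) (vectors-unique (Unique.allFin⁺ n) n)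

p213 p231 : Word 3
p213 = # 1 ∷ # 0 ∷ # 2 ∷ []
p231 = # 1 ∷ # 2 ∷ # 0 ∷ []

-- Positions are taken in all of Fin n; requiring a next position j excludes
-- the last one, so ascents and descents occur only at the first n-1.
Ascent Descent : ∀ {n} → Word n → Pred (Fin n) 0ℓ
Ascent  π i = ∃ λ j → toℕ j ≡ suc (toℕ i) × lookup π i < lookup π j
Descent π i = ∃ λ j → toℕ j ≡ suc (toℕ i) × lookup π j < lookup π i

ascent? : ∀ {n} (π : Word n) → Decidable (Ascent π)
ascent? π i = any? λ j → (toℕ j ℕ.≟ suc (toℕ i)) ×-dec (lookup π i <? lookup π j)

descent? : ∀ {n} (π : Word n) → Decidable (Descent π)
descent? π i = any? λ j → (toℕ j ℕ.≟ suc (toℕ i)) ×-dec (lookup π j <? lookup π i)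

asc des : ∀ {n} → Word n → ℕ
asc {n} π = length (filter (ascent? π) (allFin n))
des {n} π = length (filter (descent? π) (allFin n))

IsNonoverlapping : ∀ {n} → Pred (Fin n) 0ℓ → Pred (Subset n) 0ℓ
IsNonoverlapping P I =
  (∀ i → i ∈ I → P i) ×
  (∀ i j → i ∈ I → j ∈ I → i ≢ j → 2 ℕ.≤ ℕ.∣ toℕ i - toℕ j ∣)

isNonoverlapping? : ∀ {n} {P : Pred (Fin n) 0ℓ} → Decidable P → Decidable (IsNonoverlapping P)
isNonoverlapping? P? I =
  (all? λ i → (i ∈? I) →-dec P? i) ×-dec
  (all? λ i → all? λ j → (i ∈? I) →-dec (j ∈? I) →-dec ¬? (i ≟ j) →-dec
    (2 ℕ.≤? ℕ.∣ toℕ i - toℕ j ∣))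

-- The empty set always qualifies, so the default 0 of max never exceeds the
-- true maximum.
maxNonoverlapping : ∀ {n} {P : Pred (Fin n) 0ℓ} → Decidable P → ℕ
maxNonoverlapping {n} P? =
  max 0 (map ∣_∣ (filter (isNonoverlapping? P?) (vectors (true ∷ false ∷ []) n)))

MNA MND : ∀ {n} → Word n → ℕ
MNA π = maxNonoverlapping (ascent? π)
MND π = maxNonoverlapping (descent? π)

Quadruple : Set
Quadruple = ℕ × ℕ × ℕ × ℕ

_≟⁴_ : DecidableEquality Quadruple
_≟⁴_ = ≡-dec ℕ._≟_ (≡-dec ℕ._≟_ (≡-dec ℕ._≟_ ℕ._≟_))

-- Each value is taken equally often by f and by g on the list xs.
Equidistributed : {A : Set} (f g : A → Quadruple) → List A → Set
Equidistributed f g xs =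
  ∀ v → length (filter (λ x → f x ≟⁴ v) xs) ≡ length (filter (λ x → g x ≟⁴ v) xs)

-- ∑_{x ∈ xs} t₁^a t₂^b t₃^c t₄^d, where f x = (a, b, c, d).
module GeneratingFunction {c ℓ} (R : CommutativeRing c ℓ) where
  open CommutativeRing R
  open Exp semiring using (_^_)

  genFun : {A : Set} → (t₁ t₂ t₃ t₄ : Carrier) → (A → Quadruple) → List A → Carrier
  genFun t₁ t₂ t₃ t₄ f xs = List.foldr _+_ 0# (map (λ x → monomial (f x)) xs)
    where
    monomial : Quadruple → Carrier
    monomial (a , b , c , d) = t₁ ^ a * t₂ ^ b * t₃ ^ c * t₄ ^ d

{-# OPTIONS --safe #-}
-- The complement πᵢ ↦ n + 1 − πᵢ exchanges the patterns 213 and 231, so it is an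
-- involution of Sₙ(213, 231); it exchanges ascents and descents position by
-- position, hence asc with des and MNA with MND.
module Submission where

open import Defs
open import Algebra.Bundles using (CommutativeRing)
open import Data.Bool using (true; false)
open import Data.Fin using (Fin; _<_; opposite)
open import Data.Fin.Properties using (opposite-prop; opposite-involutive; toℕ<n)
open import Data.Fin.Subset using (∣_∣)
open import Data.List using ([]; _∷_; length; map; filter; foldr; allFin)
open import Data.List.Extrema.Nat using (max)
open import Data.List.Membership.Propositional using (_∈_)
open import Data.List.Membership.Propositional.Properties using (∈-map⁺; ∈-map⁻)
open import Data.List.Membership.Propositional.Properties.WithK using (unique∧set⇒bag)
open import Data.List.Properties using (filter-≐; map-cong; map-∘)
open import Data.List.Relation.Binary.BagAndSetEquality using (∼bag⇒↭)
open import Data.List.Relation.Binary.Permutation.Propositional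
  using (_↭_; ↭⇒↭ₛ′; module PermutationReasoning)
open import Data.List.Relation.Binary.Permutation.Propositional.Properties
  using (↭-length; filter-↭; map⁺)
import Data.List.Relation.Binary.Permutation.Setoid.Properties as Permutationₛ
open import Data.List.Relation.Unary.Unique.Propositional using (Unique)
import Data.List.Relation.Unary.Unique.Propositional.Properties as Unique
open import Data.Nat using (ℕ; s≤s)
open import Data.Nat.Properties using (∸-monoʳ-<)
open import Data.Product using (∃; _×_; _,_)
open import Data.Vec as Vec using (Vec; lookup)
open import Data.Vec.Properties using (lookup-map)
  renaming (map-∘ to map-∘ᵥ; map-cong to map-congᵥ; map-id to map-idᵥ)
open import Function using (_∘_; id; _⇔_; mk⇔; Equivalence)
open import Function.Properties.Equivalence using () renaming (trans to ⇔-trans; sym to ⇔-sym)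
open import Level using (0ℓ)
open import Relation.Binary.PropositionalEquality
  using (_≡_; refl; sym; trans; cong; cong₂; subst; subst₂; module ≡-Reasoning)
open import Relation.Nullary using (yes; no)
open import Relation.Unary using (Pred; Decidable; _≐_)

opposite-< : ∀ {n} {i j : Fin n} → i < j → opposite j < opposite i
opposite-< {i = i} {j} i<j
  -- `toℕ (opposite i)` is `n ∸ suc (toℕ i)`. Truncated subtraction is strictly decreasing in the
  -- subtrahend only up to `n`, hence the bound `suc (toℕ j) ≤ n` from `toℕ<n j`.
  rewrite opposite-prop i | opposite-prop j = ∸-monoʳ-< (s≤s i<j) (toℕ<n j)

opposite-<⇔ : ∀ {n} {i j : Fin n} → opposite i < opposite j ⇔ j < i
opposite-<⇔ {i = i} {j} = mk⇔
  (λ lt → subst₂ _<_ (opposite-involutive j) (opposite-involutive i) (opposite-< lt))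
  opposite-<

-- With letters counted from 0 the map is a ↦ n - 1 - a. The same function serves permutations and
-- patterns, each relative to its own alphabet.
complement : ∀ {m n} → Vec (Fin n) m → Vec (Fin n) m
complement = Vec.map opposite

complement-involutive : ∀ {m n} (π : Vec (Fin n) m) → complement (complement π) ≡ π
complement-involutive π = begin
  complement (complement π)          ≡⟨ map-∘ᵥ opposite opposite π ⟨
  Vec.map (opposite ∘ opposite) π    ≡⟨ map-congᵥ opposite-involutive π ⟩
  Vec.map id π                       ≡⟨ map-idᵥ π ⟩
  π                                  ∎
  where open ≡-Reasoning

-- Arbitrary positions are allowed, so that occurrences of patterns and ascents of adjacent letters
-- are both covered.
complement-<⇔ : ∀ {m n} (π : Vec (Fin n) m) i j →
                lookup (complement π) i < lookup (complement π) j ⇔ lookup π j < lookup π i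
complement-<⇔ π i j
  rewrite lookup-map i opposite π | lookup-map j opposite π = opposite-<⇔

complement-permutation : ∀ {n} (π : Word n) → IsPermutation π → IsPermutation (complement π)
complement-permutation π (injective , surjective) = injective′ , surjective′
  where
  opposite-injective : ∀ {n} {i j : Fin n} → opposite i ≡ opposite j → i ≡ j
  opposite-injective {i = i} {j} eq =
    trans (sym (opposite-involutive i)) (trans (cong opposite eq) (opposite-involutive j))

  injective′ : ∀ {i j} → lookup (complement π) i ≡ lookup (complement π) j → i ≡ j
  injective′ {i} {j} eq = injective (opposite-injective
    (trans (sym (lookup-map i opposite π)) (trans eq (lookup-map j opposite π))))

  surjective′ : ∀ y → ∃ λ i → ∀ {j} → j ≡ i → lookup (complement π) j ≡ y
  -- The preimage of `y` under the complement is the preimage of `opposite y` under `π`.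
  surjective′ y with i , hits ← surjective (opposite y) = i , λ { refl →
    trans (lookup-map i opposite π) (trans (cong opposite (hits refl)) (opposite-involutive y)) }

-- The positions `ι` stay the same: complementing reverses every comparison of letters, in `π` and
-- in `τ` alike, so the pattern condition at (a, b) becomes the old one at (b, a).
complement-contains : ∀ {k n} (π : Word n) (τ : Word k) →
                      Contains π τ → Contains (complement π) (complement τ)
complement-contains π τ (ι , increasing , pattern⇔) = ι , increasing , λ a b →
  ⇔-trans (complement-<⇔ π _ _) (⇔-trans (pattern⇔ b a) (⇔-sym (complement-<⇔ τ a b)))

-- An occurrence in the complement can be complemented again, and involutivity brings it back to an
-- occurrence of `τ` in `π`.
complement-avoids : ∀ {k n} (π : Word n) (τ : Word k) →
                    Avoids π τ → Avoids (complement π) (complement τ)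
complement-avoids π τ avoids contains = avoids
  (subst₂ Contains (complement-involutive π) (complement-involutive τ)
    (complement-contains (complement π) (complement τ) contains))

complement-avoider : ∀ {n} (π : Word n) →
                     IsAvoider p213 p231 π → IsAvoider p213 p231 (complement π)
complement-avoider π (permutation , avoids₂₁₃ , avoids₂₃₁) =
  complement-permutation π permutation ,
  -- `complement p231` reduces to `p213` and conversely, so the two avoidance conditions trade
  -- places by computation alone.
  complement-avoids π p231 avoids₂₃₁ ,
  complement-avoids π p213 avoids₂₁₃

-- Both lists are free of repetitions, so it suffices that they have the same members. Closure under
-- `f` gives one inclusion; writing `x` as `f (f x)` gives the other.
involution-↭ : ∀ {A : Set} {f : A → A} {xs} → (∀ x → f (f x) ≡ x) → Unique xs →
               (∀ {x} → x ∈ xs → f x ∈ xs) → map f xs ↭ xs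
involution-↭ {f = f} {xs} involutive unique closed =
  ∼bag⇒↭ (unique∧set⇒bag (Unique.map⁺ injective unique) unique (mk⇔ to from))
  where
  injective : ∀ {x y} → f x ≡ f y → x ≡ y
  injective {x} {y} eq = trans (sym (involutive x)) (trans (cong f eq) (involutive y))

  to : ∀ {x} → x ∈ map f xs → x ∈ xs
  to x∈ with _ , y∈ , refl ← ∈-map⁻ f x∈ = closed y∈

  from : ∀ {x} → x ∈ xs → x ∈ map f xs
  from {x} x∈ = subst (_∈ map f xs) (involutive x) (∈-map⁺ f (closed x∈))

complement-∈-S : ∀ {n} {π : Word n} → π ∈ S n p213 p231 → complement π ∈ S n p213 p231
complement-∈-S {n} {π} π∈S =
  Equivalence.from (∈-S⇔ {n = n} {p213} {p231} {complement π})
    (complement-avoider π (Equivalence.to (∈-S⇔ {n = n} {p213} {p231} {π}) π∈S))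

complement-↭ : ∀ n → map complement (S n p213 p231) ↭ S n p213 p231
complement-↭ n =
  involution-↭ complement-involutive (S-unique n p213 p231) (λ {π} → complement-∈-S {n} {π})

ascent-complement : ∀ {n} (π : Word n) → Ascent (complement π) ≐ Descent π
ascent-complement π =
  (λ (j , next , lt) → j , next , Equivalence.to (complement-<⇔ π _ j) lt) ,
  (λ (j , next , lt) → j , next , Equivalence.from (complement-<⇔ π _ j) lt)

descent-complement : ∀ {n} (π : Word n) → Descent (complement π) ≐ Ascent π
descent-complement π =
  (λ (j , next , lt) → j , next , Equivalence.to (complement-<⇔ π j _) lt) ,
  (λ (j , next , lt) → j , next , Equivalence.from (complement-<⇔ π j _) lt)

-- The predicate enters only through the members of `I`, while the spacing condition concerns
-- positions alone. Hence both filters select the same list of subsets.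
maxNonoverlapping-≐ : ∀ {n} {P Q : Pred (Fin n) 0ℓ} (P? : Decidable P) (Q? : Decidable Q) →
                      P ≐ Q → maxNonoverlapping P? ≡ maxNonoverlapping Q?
maxNonoverlapping-≐ P? Q? (P⊆Q , Q⊆P) = cong (max 0 ∘ map ∣_∣)
  (filter-≐ (isNonoverlapping? P?) (isNonoverlapping? Q?)
    ( (λ (⊆P , spread) → (λ i i∈ → P⊆Q (⊆P i i∈)) , spread)
    , (λ (⊆Q , spread) → (λ i i∈ → Q⊆P (⊆Q i i∈)) , spread))
    (vectors (true ∷ false ∷ []) _))

statistics reversedStatistics : ∀ {n} → Word n → Quadruple
statistics         π = asc π , des π , MNA π , MND π
reversedStatistics π = des π , asc π , MND π , MNA π

statistics-complement : ∀ {n} (π : Word n) → statistics (complement π) ≡ reversedStatistics π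
statistics-complement {n} π =
  cong₂ _,_ (cong length (filter-≐ A′ D (ascent-complement π) (allFin n)))
  (cong₂ _,_ (cong length (filter-≐ D′ A (descent-complement π) (allFin n)))
  (cong₂ _,_ (maxNonoverlapping-≐ A′ D (ascent-complement π))
             (maxNonoverlapping-≐ D′ A (descent-complement π))))
  where
  A = ascent? π
  D = descent? π
  A′ = ascent? (complement π)
  D′ = descent? (complement π)

-- Common source of both halves of the theorem: the counts and the generating function each depend
-- only on the multiset of values of the statistics. That multiset is reindexed along the
-- complement.
statistics-↭ : ∀ n → map statistics (S n p213 p231) ↭ map reversedStatistics (S n p213 p231)
statistics-↭ n = begin
  map statistics Sₙ                    ↭⟨ map⁺ statistics (complement-↭ n) ⟨
  map statistics (map complement Sₙ)   ≡⟨ map-∘ Sₙ ⟨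
  map (statistics ∘ complement) Sₙ     ≡⟨ map-cong statistics-complement Sₙ ⟩
  map reversedStatistics Sₙ            ∎
  where
  open PermutationReasoning
  Sₙ = S n p213 p231

length-filter-map : ∀ {A B : Set} {P : Pred B 0ℓ} (P? : Decidable P) (f : A → B) xs →
                    length (filter P? (map f xs)) ≡ length (filter (P? ∘ f) xs)
length-filter-map P? f []       = refl
length-filter-map P? f (x ∷ xs) with P? (f x)
... | yes _ = cong ℕ.suc (length-filter-map P? f xs)
... | no  _ = length-filter-map P? f xs

-- Moved from `xs` to the list of values, the count becomes the multiplicity of `v`, which a
-- permutation preserves.
↭⇒equidistributed : ∀ {A : Set} {f g : A → Quadruple} {xs} →
                    map f xs ↭ map g xs → Equidistributed f g xs
↭⇒equidistributed {f = f} {g} {xs} f↭g v = begin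
  length (filter ((_≟⁴ v) ∘ f) xs)    ≡⟨ length-filter-map (_≟⁴ v) f xs ⟨
  length (filter (_≟⁴ v) (map f xs))  ≡⟨ ↭-length (filter-↭ (_≟⁴ v) f↭g) ⟩
  length (filter (_≟⁴ v) (map g xs))  ≡⟨ length-filter-map (_≟⁴ v) g xs ⟩
  length (filter ((_≟⁴ v) ∘ g) xs)    ∎
  where open ≡-Reasoning

module _ {c ℓ} (R : CommutativeRing c ℓ) where
  open CommutativeRing R hiding (refl; sym; trans)
  open GeneratingFunction R
  open import Relation.Binary.Reasoning.Setoid setoid

  ↭⇒genFun : ∀ {A : Set} {f g : A → Quadruple} {xs} t₁ t₂ t₃ t₄ → map f xs ↭ map g xs →
             genFun t₁ t₂ t₃ t₄ f xs ≈ genFun t₁ t₂ t₃ t₄ g xs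
  ↭⇒genFun {f = f} {g} {xs} t₁ t₂ t₃ t₄ f↭g = begin
    -- Taking `id` as the statistic turns the sum into one over the list of values.
    genFun t₁ t₂ t₃ t₄ f xs            ≡⟨ cong (foldr _+_ 0#) (map-∘ xs) ⟩
    genFun t₁ t₂ t₃ t₄ id (map f xs)   ≈⟨ Permutationₛ.foldr-commMonoid setoid
                                            +-isCommutativeMonoid
                                            -- The underscore stands for the monomial, which is
                                            -- local to `genFun`. The permutation is weakened to one
                                            -- up to `≈`, the equality in which addition is
                                            -- commutative.
                                            (↭⇒↭ₛ′ isEquivalence (map⁺ _ f↭g)) ⟩
    genFun t₁ t₂ t₃ t₄ id (map g xs)   ≡⟨ cong (foldr _+_ 0#) (map-∘ xs) ⟨
    genFun t₁ t₂ t₃ t₄ g xs            ∎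

theorem13 : ∀ {c ℓ} (n : ℕ) →
    Equidistributed (λ π → asc π , des π , MNA π , MND π)
    (λ π → des π , asc π , MND π , MNA π)
    (S n p213 p231)
    × ((R : CommutativeRing c ℓ) →
    let open CommutativeRing R
        open GeneratingFunction R
    in ∀ (t₁ t₂ t₃ t₄ : Carrier) →
    genFun t₁ t₂ t₃ t₄ (λ π → asc π , des π , MNA π , MND π) (S n p213 p231)
    ≈ genFun t₁ t₂ t₃ t₄ (λ π → des π , asc π , MND π , MNA π) (S n p213 p231))
theorem13 n =
  ↭⇒equidistributed (statistics-↭ n) ,
  λ R t₁ t₂ t₃ t₄ → ↭⇒genFun R t₁ t₂ t₃ t₄ (statistics-↭ n)
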